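{- Let $F\colon\mathbb{F}_{2^n}\to\mathbb{F}_{2^4}$ be a bent function. Then there are only 14 possible preimage distributions for $F$, which are the distributions with preimage set sizes $X_i=2^{n-4}+2^{n/2-4}(2T_i-1)$, $i=1,\dots,16$, where the $T_i$ are one of the following (up to reordering): 1. $T_1=-6$, $T_2=\dots=T_9=0$, $T_{10}=\dots=T_{16}=2$; 2. $T_1=-4$, $T_2=T_3=-2$, $T_4=\dots=T_9=0$, $T_{10}=\dots=T_{15}=2$, $T_{16}=4$; 3. $T_1=-4$, $T_2=\dots=T_{13}=0$, $T_{14}=T_{15}=T_{16}=4$; 4. $T_1=\dots=T_6=-2$, $T_7=\dots=T_{16}=2$; 5. $T_1=\dots=T_4=-2$, $T_5=\dots=T_{10}=0$, $T_{11}=\dots=T_{14}=2$, $T_{15}=T_{16}=4$; 6. $T_1=T_2=T_3=-2$, $T_4=\dots=T_{11}=0$, $T_{12}=\dots=T_{15}=2$, $T_{16}=6$; 7. $T_1=\dots=T_{15}=0$, $T_{16}=8$; 8. the symmetric solutions $\{ -T_1+1,-T_2+1,\dots,-T_{16}+1\}$ for each of the 7 solutions above.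
   Context: A function $F\colon\mathbb{F}_{2^n}\to\mathbb{F}_{2^m}$ is bent (perfect nonlinear) if $|\{x: F(x+a)-F(x)=b\}|=2^{n-m}$ for all nonzero $a\in\mathbb{F}_{2^n}$ and all $b\in\mathbb{F}_{2^m}$. The preimage distribution of $F$ is the multiset $\{X_1,\dots,X_{2^m}\}$ of the sizes $|F^{ -1}(\beta)|$, $\beta\in\mathbb{F}_{2^m}$. The theorem asserts that the preimage distribution of every such $F$ is one of the 14 listed. -}

module Defs where

open import Algebra.Bundles using (CommutativeRing)
open import Data.Fin using (Fin)
open import Data.Fin.Properties using (inj⇒≟)
open import Data.Integer as ℤ using (ℤ; +_; -[1+_])
open import Data.List using (List; []; _∷_; _++_; map; filter; length; replicate; tabulate)
open import Data.Nat as ℕ using (ℕ; suc)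
open import Data.Nat.Properties using (m^n≢0)
open import Data.Product using (∃)
open import Data.Rational as ℚ using (ℚ)
open import Function.Bundles using (Func; Inverse)
open import Function.Properties.Inverse using (Inverse⇒Injection)
open import Level using (Level; _⊔_) renaming (suc to lsuc)
open import Relation.Binary.Definitions using (Decidable)
open import Relation.Binary.PropositionalEquality using (_≡_; setoid)
open import Relation.Nullary using (¬_)
import Relation.Unary as Unary

private
  variable
    c₁ ℓ₁ c₂ ℓ₂ : Level

record FiniteField (c ℓ : Level) (q : ℕ) : Set (lsuc (c ⊔ ℓ)) where
  field
    commutativeRing : CommutativeRing c ℓ

  open CommutativeRing commutativeRing public renaming (setoid to ≈-setoid)

  field
    0≉1         : ¬ 0# ≈ 1#
    invertible  : ∀ x → ¬ x ≈ 0# → ∃ λ y → x * y ≈ 1#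
    enumeration : Inverse ≈-setoid (setoid (Fin q))

  infix 4 _≟_
  _≟_ : Decidable _≈_
  _≟_ = inj⇒≟ (Inverse⇒Injection enumeration)

  -- Every element occurs exactly once, up to _≈_.
  elements : List Carrier
  elements = tabulate (Inverse.from enumeration)

  card : ∀ {p} {P : Unary.Pred Carrier p} → Unary.Decidable P → ℕ
  card P? = length (filter P? elements)

fromℤ : ℤ → ℚ
fromℤ i = i ℚ./ 1

-- Exponents such as n - m and n/2 - 4 are not assumed to be nonnegative, so
-- powers of two are taken in ℚ.
2^_ : ℤ → ℚ
2^ (+ n)    = fromℤ (+ (2 ℕ.^ n))
2^ -[1+ n ] = ℚ._/_ (+ 1) (2 ℕ.^ suc n) {{m^n≢0 2 (suc n)}}

module _ {n m : ℕ}
         (K : FiniteField c₁ ℓ₁ (2 ℕ.^ n)) (L : FiniteField c₂ ℓ₂ (2 ℕ.^ m))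
         (F : Func (FiniteField.≈-setoid K) (FiniteField.≈-setoid L)) where

  private
    module K = FiniteField K
    module L = FiniteField L
  open Func F using (to)

  Bent : Set _
  Bent = ∀ a → ¬ a K.≈ K.0# → ∀ b →
    fromℤ (+ K.card (λ x → (to (x K.+ a) L.- to x) L.≟ b)) ≡ 2^ (+ n ℤ.- + m)

  -- A multiset is represented by a list, to be compared up to permutation.
  preimageDistribution : List ℕ
  preimageDistribution = map (λ β → K.card (λ x → to x L.≟ β)) L.elements

preimageSize : ℕ → ℤ → ℚ
preimageSize n t =
  2^ (+ n ℤ.- + 4) ℚ.+ 2^ (+ (n ℕ./ 2) ℤ.- + 4) ℚ.* fromℤ (+ 2 ℤ.* t ℤ.- + 1)

basicSolutions : List (List ℤ)
basicSolutions =
    (ℤ.- + 6 ∷ replicate 8 (+ 0) ++ replicate 7 (+ 2))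
  ∷ (ℤ.- + 4 ∷ replicate 2 (ℤ.- + 2) ++ replicate 6 (+ 0) ++ replicate 6 (+ 2) ++ + 4 ∷ [])
  ∷ (ℤ.- + 4 ∷ replicate 12 (+ 0) ++ replicate 3 (+ 4))
  ∷ (replicate 6 (ℤ.- + 2) ++ replicate 10 (+ 2))
  ∷ (replicate 4 (ℤ.- + 2) ++ replicate 6 (+ 0) ++ replicate 4 (+ 2) ++ replicate 2 (+ 4))
  ∷ (replicate 3 (ℤ.- + 2) ++ replicate 8 (+ 0) ++ replicate 4 (+ 2) ++ + 6 ∷ [])
  ∷ (replicate 15 (+ 0) ++ + 8 ∷ [])
  ∷ []

symmetricSolution : List ℤ → List ℤ
symmetricSolution = map (λ t → ℤ.- t ℤ.+ + 1)

solutions : List (List ℤ)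
solutions = basicSolutions ++ map symmetricSolution basicSolutions

{-# OPTIONS --safe #-}
module Submission where

-- In coordinates L ≅ 𝔽₂⁴, the sum W(u) = Σₓ (-1)^(u·F(x)) satisfies W(u)² = 2ⁿ for
-- u ≠ 0: expanding the square gives Σₐ Σₓ (-1)^(u·(F(x+a)-F(x))), where only a = 0
-- contributes because x ↦ F(x+a)-F(x) takes every value equally often for a ≠ 0.
-- Hence n = 2h and W(u) = 2ʰ ε(u) with ε(u) = ±1, and Fourier inversion gives
-- 16 |F⁻¹(v)| = 2ⁿ + 2ʰ (ε̂(v) - 1), where ε(0) = 1. So the preimage distribution
-- is determined by the multiset of values of ε̂ = 2T, and the sign functions on 𝔽₂⁴
-- are examined exhaustively.

open import Defs
import Algebra.Properties.CommutativeMonoid.Sum as MonoidSum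
import Algebra.Properties.Monoid.Mult as Mult
import Algebra.Properties.Ring as RingProperties
open import Data.Bool using (Bool; true; false; if_then_else_; _xor_)
import Data.Bool.Properties as Bool
open import Data.Fin using (Fin; zero; suc; punchIn)
open import Data.Fin.Permutation using (Permutation; permutation)
open import Data.Fin.Properties using (punchInᵢ≢i; all?; ¬∀⟶∃¬; injective⇒≤; *↔×; 2↔Bool)
open import Data.Integer as ℤ using (ℤ; +_; 0ℤ; 1ℤ; -1ℤ; ∣_∣)
import Data.Integer.Properties as ℤ
open import Data.Integer.Tactic.RingSolver using (solve-∀)
open import Data.List using (List; []; _∷_; _++_; map; foldr; zipWith; cartesianProductWith; length; filter; tabulate; allFin)
open import Data.List.Membership.Propositional using (_∈_; lose)
open import Data.List.Membership.Propositional.Properties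
  using (∈-++⁺ˡ; ∈-++⁺ʳ; ∈-map⁺; ∈-map⁻; ∈-cartesianProductWith⁺; ∈-allFin)
open import Data.List.Membership.Propositional.Properties.WithK using (unique∧set⇒bag)
open import Data.List.Properties using (≡-dec; map-∘; map-cong; map-++; map-tabulate)
open import Data.List.Membership.DecPropositional (≡-dec ℤ._≟_) using (_∈?_)
open import Data.List.Relation.Binary.BagAndSetEquality using (∼bag⇒↭)
open import Data.List.Relation.Binary.Permutation.Propositional
  using (_↭_; ↭-refl; ↭-reflexive; ↭-sym; ↭-trans; prep; swap; module PermutationReasoning)
import Data.List.Relation.Binary.Permutation.Propositional.Properties as Perm
open import Data.List.Relation.Unary.All as All using (All)
open import Data.List.Relation.Unary.Any as Any using (here; there)
open import Data.List.Relation.Unary.Unique.Propositional using (Unique; []; _∷_)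
import Data.List.Relation.Unary.Unique.Propositional.Properties as Unique
open import Data.Nat as ℕ using (ℕ; zero; suc; _^_)
open import Data.Nat.Divisibility using (_∣_; divides)
open import Data.Nat.DivMod using (m*n/n≡m)
open import Data.Nat.Primality using (euclidsLemma; prime[2])
import Data.Nat.Properties as ℕ
import Data.Nat.Tactic.RingSolver as ℕ-RingSolver
open import Data.Product using (_×_; ∃; _,_; proj₁; proj₂)
open import Data.Product.Function.NonDependent.Propositional using (_×-↔_)
open import Data.Rational as ℚ using (ℚ)
import Data.Rational.Properties as ℚ
import Data.Rational.Unnormalised as ℚᵘ
import Data.Rational.Unnormalised.Properties as ℚᵘ
open import Data.Sum using (_⊎_; inj₁; inj₂)
open import Data.Vec as Vec using (Vec; []; _∷_; replicate)
import Data.Vec.Properties as Vec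
open import Function using (_∘_; Inverse; Injection; _↔_; mk↔ₛ′; mk⇔)
open import Function.Bundles using (Func)
open import Function.Properties.Inverse using (Inverse⇒Injection; ↔-sym; ↔-trans)
open import Level using (Level; _⊔_)
open import Relation.Binary.PropositionalEquality
open import Relation.Nullary using (¬_; Dec; yes; no; does; contradiction)
open import Relation.Nullary.Decidable using (map′; toWitness; decidable-stable)
import Relation.Unary as Unary

open import Algebra.Properties.Semiring.Sum ℤ.+-*-semiring
  using (sum; sum-cong-≗; ∑-distrib-+; ∑-comm; sum-remove; sum-permute; sum-replicate-zero; *-distribˡ-sum; *-distribʳ-sum)

-- Each `ε̂(v)` is a sum of sixteen signs, hence even, which is why it can be written as `2T` with
-- `T` an integer. The symmetric solutions come from reversing every sign except `ε(0)`: this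
-- replaces `ε` by `2δ₀ - ε`, hence `ε̂` by `2 - ε̂` and `T` by `1 - T`. Multiplication enters at
-- one place only: it forces characteristic 2 on the codomain, which makes its additive group a
-- vector space over 𝔽₂. Coordinates are then built by adjoining independent elements one at a time,
-- with cardinalities in place of a theory of dimension. No lower bound on `n` is at hand, so
-- `2^(n-4)` and `2^(h-4)` have to be treated as possibly proper fractions. The counting identities
-- therefore stay in ℤ, multiplied by 16, and pass to ℚ only at the end.

private
  variable
    a b c c₁ c₂ ℓ ℓ₁ ℓ₂ p : Level
    A : Set a
    B : Set b
    k n q r : ℕ

-- Spectra of sign functions

-- Duplicate-free lists with the same members are equal as bags, hence permutations of each other.
-- This serves both for translations of the cube and for matching coordinates with the enumeration
-- of a field.
map-bijection-↭ : {f : A → B} {xs : List A} {ys : List B} →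
  (∀ {x y} → f x ≡ f y → x ≡ y) → (∀ y → ∃ λ x → f x ≡ y) →
  Unique xs → (∀ x → x ∈ xs) → Unique ys → (∀ y → y ∈ ys) → map f xs ↭ ys
map-bijection-↭ {f = f} {xs} {ys} inj surj xs! ∈xs ys! ∈ys =
  ∼bag⇒↭ (unique∧set⇒bag (Unique.map⁺ inj xs!) ys! (mk⇔ (λ _ → ∈ys _) (λ _ → covered _)))
  where
  covered : ∀ y → y ∈ map f xs
  covered y with surj y
  ... | x , refl = ∈-map⁺ f (∈xs x)

infixr 6 _⊕_
_⊕_ : Vec Bool k → Vec Bool k → Vec Bool k
_⊕_ = Vec.zipWith _xor_

𝟎 : Vec Bool k
𝟎 = replicate _ false

⊕-cancelˡ : (v w : Vec Bool k) → v ⊕ v ⊕ w ≡ w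
⊕-cancelˡ []          []      = refl
⊕-cancelˡ (b ∷ v) (d ∷ w) = cong₂ _∷_ (xor-cancelˡ b d) (⊕-cancelˡ v w)
  where
  xor-cancelˡ : ∀ x y → x xor (x xor y) ≡ y
  xor-cancelˡ false y = refl
  xor-cancelˡ true  y = Bool.not-involutive y

cube : ∀ k → List (Vec Bool k)
cube zero    = [] ∷ []
cube (suc k) = map (false ∷_) (cube k) ++ map (true ∷_) (cube k)

∈-cube : (v : Vec Bool k) → v ∈ cube k
∈-cube []          = here refl
∈-cube (false ∷ v) = ∈-++⁺ˡ (∈-map⁺ _ (∈-cube v))
∈-cube (true  ∷ v) = ∈-++⁺ʳ _ (∈-map⁺ _ (∈-cube v))

cube-unique : ∀ k → Unique (cube k)
cube-unique zero    = All.[] ∷ []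
cube-unique (suc k) =
  Unique.++⁺ (Unique.map⁺ Vec.∷-injectiveʳ (cube-unique k))
             (Unique.map⁺ Vec.∷-injectiveʳ (cube-unique k)) disjoint
  where
  disjoint : ∀ {v} → ¬ (v ∈ map (false ∷_) (cube k) × v ∈ map (true ∷_) (cube k))
  disjoint (p , q) with ∈-map⁻ (false ∷_) p | ∈-map⁻ (true ∷_) q
  ... | _ , _ , refl | _ , _ , ()

cube-translate : (b : Vec Bool k) → map (b ⊕_) (cube k) ↭ cube k
cube-translate {k} b = map-bijection-↭
  (λ {x} {y} e → trans (sym (⊕-cancelˡ b x)) (trans (cong (b ⊕_) e) (⊕-cancelˡ b y)))
  (λ y → b ⊕ y , ⊕-cancelˡ b y)
  (cube-unique k) ∈-cube (cube-unique k) ∈-cube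

-- sgn u v = (-1)^(u·v)
sgn : Vec Bool k → Vec Bool k → ℤ
sgn []          []          = 1ℤ
sgn (false ∷ u) (_     ∷ v) = sgn u v
sgn (true  ∷ u) (false ∷ v) = sgn u v
sgn (true  ∷ u) (true  ∷ v) = ℤ.- sgn u v

IsSign : ℤ → Set
IsSign s = s ≡ 1ℤ ⊎ s ≡ -1ℤ

neg-isSign : ∀ {s} → IsSign s → IsSign (ℤ.- s)
neg-isSign (inj₁ refl) = inj₂ refl
neg-isSign (inj₂ refl) = inj₁ refl

*-isSign : ∀ {s t} → IsSign s → IsSign t → IsSign (s ℤ.* t)
*-isSign (inj₁ refl) (inj₁ refl) = inj₁ refl
*-isSign (inj₁ refl) (inj₂ refl) = inj₂ refl
*-isSign (inj₂ refl) (inj₁ refl) = inj₂ refl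
*-isSign (inj₂ refl) (inj₂ refl) = inj₁ refl

isSign-square : ∀ {s} → IsSign s → s ℤ.* s ≡ 1ℤ
isSign-square (inj₁ refl) = refl
isSign-square (inj₂ refl) = refl

sgn-isSign : (u v : Vec Bool k) → IsSign (sgn u v)
sgn-isSign []          []          = inj₁ refl
sgn-isSign (false ∷ u) (_     ∷ v) = sgn-isSign u v
sgn-isSign (true  ∷ u) (false ∷ v) = sgn-isSign u v
sgn-isSign (true  ∷ u) (true  ∷ v) = neg-isSign (sgn-isSign u v)

sgn-𝟎ˡ : (v : Vec Bool k) → sgn 𝟎 v ≡ 1ℤ
sgn-𝟎ˡ []      = refl
sgn-𝟎ˡ (_ ∷ v) = sgn-𝟎ˡ v

sgn-𝟎ʳ : (u : Vec Bool k) → sgn u 𝟎 ≡ 1ℤ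
sgn-𝟎ʳ []          = refl
sgn-𝟎ʳ (false ∷ u) = sgn-𝟎ʳ u
sgn-𝟎ʳ (true  ∷ u) = sgn-𝟎ʳ u

sgn-⊕ : (u v w : Vec Bool k) → sgn u (v ⊕ w) ≡ sgn u v ℤ.* sgn u w
sgn-⊕ []          []          []          = refl
sgn-⊕ (false ∷ u) (_     ∷ v) (_     ∷ w) = sgn-⊕ u v w
sgn-⊕ (true  ∷ u) (false ∷ v) (false ∷ w) = sgn-⊕ u v w
sgn-⊕ (true  ∷ u) (false ∷ v) (true  ∷ w) =
  trans (cong ℤ.-_ (sgn-⊕ u v w)) (ℤ.neg-distribʳ-* (sgn u v) (sgn u w))
sgn-⊕ (true  ∷ u) (true  ∷ v) (false ∷ w) =
  trans (cong ℤ.-_ (sgn-⊕ u v w)) (ℤ.neg-distribˡ-* (sgn u v) (sgn u w))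
sgn-⊕ (true  ∷ u) (true  ∷ v) (true  ∷ w) =
  trans (sgn-⊕ u v w) (neg-*-neg (sgn u v) (sgn u w))
  where
  neg-*-neg : ∀ x y → x ℤ.* y ≡ ℤ.- x ℤ.* ℤ.- y
  neg-*-neg = solve-∀

sgn-nontrivial : (u : Vec Bool k) → u ≢ 𝟎 → ∃ λ v → sgn u v ≡ -1ℤ
sgn-nontrivial []          u≢𝟎 = contradiction refl u≢𝟎
sgn-nontrivial (false ∷ u) u≢𝟎 with sgn-nontrivial u (u≢𝟎 ∘ cong (false ∷_))
... | v , e = false ∷ v , e
sgn-nontrivial (true  ∷ u) _   = true ∷ 𝟎 , cong ℤ.-_ (sgn-𝟎ʳ u)

-- hat f v = Σᵤ (-1)^(u·v) f(u)
hat : (Vec Bool k → ℤ) → Vec Bool k → ℤ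
hat f []          = f []
hat f (false ∷ v) = hat (f ∘ (false ∷_)) v ℤ.+ hat (f ∘ (true ∷_)) v
hat f (true  ∷ v) = hat (f ∘ (false ∷_)) v ℤ.- hat (f ∘ (true ∷_)) v

hat-cong : {f g : Vec Bool k → ℤ} → f ≗ g → hat f ≗ hat g
hat-cong f≗g []          = f≗g []
hat-cong f≗g (false ∷ v) = cong₂ ℤ._+_ (hat-cong (f≗g ∘ (false ∷_)) v) (hat-cong (f≗g ∘ (true ∷_)) v)
hat-cong f≗g (true  ∷ v) = cong₂ ℤ._-_ (hat-cong (f≗g ∘ (false ∷_)) v) (hat-cong (f≗g ∘ (true ∷_)) v)

hat-* : ∀ d (f : Vec Bool k → ℤ) v → hat (λ u → d ℤ.* f u) v ≡ d ℤ.* hat f v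
hat-* d f []          = refl
hat-* d f (false ∷ v) =
  trans (cong₂ ℤ._+_ (hat-* d _ v) (hat-* d _ v)) (sym (ℤ.*-distribˡ-+ d _ _))
hat-* d f (true  ∷ v) =
  trans (cong₂ ℤ._-_ (hat-* d _ v) (hat-* d _ v)) (lemma d _ _)
  where
  lemma : ∀ d x y → d ℤ.* x ℤ.- d ℤ.* y ≡ d ℤ.* (x ℤ.- y)
  lemma = solve-∀

hat-neg : (f : Vec Bool k → ℤ) → ∀ v → hat (ℤ.-_ ∘ f) v ≡ ℤ.- hat f v
hat-neg f v = trans (hat-cong (sym ∘ ℤ.-1*i≡-i ∘ f) v)
  (trans (hat-* -1ℤ f v) (ℤ.-1*i≡-i (hat f v)))

sum-neg : (f : Fin n → ℤ) → sum (ℤ.-_ ∘ f) ≡ ℤ.- sum f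
sum-neg f = trans (sum-cong-≗ (sym ∘ ℤ.-1*i≡-i ∘ f))
  (trans (sym (*-distribˡ-sum -1ℤ f)) (ℤ.-1*i≡-i (sum f)))

hat-sum : (f : Fin n → Vec Bool k → ℤ) → ∀ v →
  hat (λ u → sum (λ i → f i u)) v ≡ sum (λ i → hat (f i) v)
hat-sum f []          = refl
hat-sum f (false ∷ v) = trans
  (cong₂ ℤ._+_ (hat-sum (λ i → f i ∘ (false ∷_)) v) (hat-sum (λ i → f i ∘ (true ∷_)) v))
  (sym (∑-distrib-+ (λ i → hat (f i ∘ (false ∷_)) v) (λ i → hat (f i ∘ (true ∷_)) v)))
hat-sum f (true  ∷ v) = trans
  (cong₂ ℤ._+_ (hat-sum (λ i → f i ∘ (false ∷_)) v)
    (trans (cong ℤ.-_ (hat-sum (λ i → f i ∘ (true ∷_)) v)) (sym (sum-neg (λ i → hat (f i ∘ (true ∷_)) v)))))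
  (sym (∑-distrib-+ (λ i → hat (f i ∘ (false ∷_)) v) (λ i → ℤ.- hat (f i ∘ (true ∷_)) v)))

-- The difference of `f` and `g` is a point mass at `𝟎`, and the transform of such a point mass is
-- constant. In the recursion it always lies in the `false` half, so it is added in both branches.
hat-except-𝟎 : (f g : Vec Bool k → ℤ) → (∀ u → u ≢ 𝟎 → f u ≡ g u) →
  ∀ v → hat f v ≡ hat g v ℤ.+ (f 𝟎 ℤ.- g 𝟎)
hat-except-𝟎 f g _   []      = lemma (f []) (g [])
  where
  lemma : ∀ x y → x ≡ y ℤ.+ (x ℤ.- y)
  lemma = solve-∀
hat-except-𝟎 f g f≗g (b ∷ v)
  with hat-except-𝟎 (f ∘ (false ∷_)) (g ∘ (false ∷_)) (λ u u≢ → f≗g (false ∷ u) (u≢ ∘ Vec.∷-injectiveʳ)) v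
  | hat-cong {f = f ∘ (true ∷_)} {g ∘ (true ∷_)} (λ u → f≗g (true ∷ u) λ ()) v
hat-except-𝟎 f g f≗g (false ∷ v) | e₀ | e₁ = trans (cong₂ ℤ._+_ e₀ e₁)
  (lemma (hat (g ∘ (false ∷_)) v) (hat (g ∘ (true ∷_)) v) (f 𝟎 ℤ.- g 𝟎))
  where
  lemma : ∀ x y d → x ℤ.+ d ℤ.+ y ≡ x ℤ.+ y ℤ.+ d
  lemma = solve-∀
hat-except-𝟎 f g f≗g (true ∷ v) | e₀ | e₁ = trans (cong₂ ℤ._-_ e₀ e₁)
  (lemma (hat (g ∘ (false ∷_)) v) (hat (g ∘ (true ∷_)) v) (f 𝟎 ℤ.- g 𝟎))
  where
  lemma : ∀ x y d → x ℤ.+ d ℤ.- y ≡ x ℤ.- y ℤ.+ d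
  lemma = solve-∀

hat-translate : (b : Vec Bool k) (f : Vec Bool k → ℤ) → ∀ v →
  hat (λ u → sgn b u ℤ.* f u) v ≡ hat f (b ⊕ v)
hat-translate []          f []          = ℤ.*-identityˡ (f [])
hat-translate (false ∷ b) f (false ∷ v) = cong₂ ℤ._+_ (hat-translate b _ v) (hat-translate b _ v)
hat-translate (false ∷ b) f (true  ∷ v) = cong₂ ℤ._-_ (hat-translate b _ v) (hat-translate b _ v)
-- The extra sign falls on the `true` half only, so it exchanges the sum branch with the difference
-- branch, as flipping the first bit of the argument does.
hat-translate (true  ∷ b) f = go
  where
  h₁ : ∀ v → hat (λ u → ℤ.- sgn b u ℤ.* f (true ∷ u)) v ≡ ℤ.- hat (f ∘ (true ∷_)) (b ⊕ v)
  h₁ v = trans (hat-cong (λ u → sym (ℤ.neg-distribˡ-* (sgn b u) (f (true ∷ u)))) v)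
    (trans (hat-neg _ v) (cong ℤ.-_ (hat-translate b _ v)))
  go : ∀ v → hat (λ u → sgn (true ∷ b) u ℤ.* f u) v ≡ hat f ((true ∷ b) ⊕ v)
  go (false ∷ v) = cong₂ ℤ._+_ (hat-translate b _ v) (h₁ v)
  go (true  ∷ v) = trans (cong₂ ℤ._-_ (hat-translate b _ v) (h₁ v))
    (cong (λ x → hat (f ∘ (false ∷_)) (b ⊕ v) ℤ.+ x) (ℤ.neg-involutive _))

-- Orthogonality of characters: the sum over `u` factors over the coordinates, with `1 + 1` where
-- the two vectors agree and `1 - 1` where they differ.
hat-sgn-≡ : (v : Vec Bool k) → hat (λ u → sgn u v) v ≡ + (2 ^ k)
hat-sgn-≢ : (v w : Vec Bool k) → w ≢ v → hat (λ u → sgn u w) v ≡ 0ℤ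

hat-sgn-≡ []          = refl
hat-sgn-≡ {suc k} (false ∷ v) = trans (cong₂ ℤ._+_ (hat-sgn-≡ v) (hat-sgn-≡ v))
  (cong (λ x → + (2 ^ k ℕ.+ x)) (sym (ℕ.+-identityʳ (2 ^ k))))
hat-sgn-≡ {suc k} (true  ∷ v) = trans
  (cong₂ ℤ._-_ (hat-sgn-≡ v) (trans (hat-neg (λ u → sgn u v) v) (cong ℤ.-_ (hat-sgn-≡ v))))
  (trans (cong (λ x → + (2 ^ k) ℤ.+ x) (ℤ.neg-involutive (+ (2 ^ k))))
    (cong (λ x → + (2 ^ k ℕ.+ x)) (sym (ℕ.+-identityʳ (2 ^ k)))))

hat-sgn-≢ []          []          w≢v = contradiction refl w≢v
hat-sgn-≢ (false ∷ v) (false ∷ w) w≢v = cong₂ ℤ._+_ e e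
  where e = hat-sgn-≢ v w (w≢v ∘ cong (false ∷_))
hat-sgn-≢ (false ∷ v) (true  ∷ w) w≢v =
  trans (cong (λ x → hat (λ u → sgn u w) v ℤ.+ x) (hat-neg (λ u → sgn u w) v)) (ℤ.+-inverseʳ (hat (λ u → sgn u w) v))
hat-sgn-≢ (true  ∷ v) (false ∷ w) w≢v = ℤ.+-inverseʳ (hat (λ u → sgn u w) v)
hat-sgn-≢ (true  ∷ v) (true  ∷ w) w≢v =
  cong₂ ℤ._-_ e (trans (hat-neg (λ u → sgn u w) v) (cong ℤ.-_ e))
  where e = hat-sgn-≢ v w (w≢v ∘ cong (true ∷_))

-- Enumeration of the possible spectra

-- One stage of the fast Walsh-Hadamard transform. The sums precede the differences because `cube`
-- lists the vectors with first bit `false` before the others.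
butterfly : List ℤ → List ℤ → List ℤ
butterfly xs ys = zipWith ℤ._+_ xs ys ++ zipWith ℤ._-_ xs ys

spectrum : (Vec Bool k → ℤ) → List ℤ
spectrum {k} f = map (hat f) (cube k)

spectrum-suc : (f : Vec Bool (suc k) → ℤ) →
  spectrum f ≡ butterfly (spectrum (f ∘ (false ∷_))) (spectrum (f ∘ (true ∷_)))
spectrum-suc {k} f = trans (map-++ (hat f) (map (false ∷_) (cube k)) (map (true ∷_) (cube k))) (cong₂ _++_
  (trans (sym (map-∘ (cube k))) (sym (zipWith-diagonal (cube k))))
  (trans (sym (map-∘ (cube k))) (sym (zipWith-diagonal (cube k)))))
  where
  zipWith-diagonal : ∀ {_∙_ : ℤ → ℤ → ℤ} {f g : A → ℤ} xs →
    zipWith _∙_ (map f xs) (map g xs) ≡ map (λ x → f x ∙ g x) xs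
  zipWith-diagonal []       = refl
  zipWith-diagonal (x ∷ xs) = cong (_ ∷_) (zipWith-diagonal xs)

spectrum-translate : (b : Vec Bool k) (f : Vec Bool k → ℤ) →
  spectrum (λ u → sgn b u ℤ.* f u) ↭ spectrum f
spectrum-translate {k} b f = ↭-trans
  (↭-reflexive (trans (map-cong (hat-translate b f) (cube k)) (map-∘ (cube k))))
  (Perm.map⁺ (hat f) (cube-translate b))

-- Translating the spectrum of f multiplies f by a character, so f may be assumed to be 1
-- at 0 and at the basis vectors; this leaves 2¹¹ sign functions on 𝔽₂⁴.
Normalised : (Vec Bool k → ℤ) → Set
Normalised {zero}  f = f [] ≡ 1ℤ
Normalised {suc k} f = Normalised (f ∘ (false ∷_)) × f (true ∷ 𝟎) ≡ 1ℤ

-- At a basis vector `sgn b` is -1 exactly when the corresponding bit of `b` is `true`, so the bits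
-- can be read off from the signs of `f` there. The value at `𝟎` is unaffected.
normalise : (f : Vec Bool k → ℤ) → (∀ u → IsSign (f u)) → f 𝟎 ≡ 1ℤ →
  ∃ λ b → Normalised (λ u → sgn b u ℤ.* f u)
normalise {zero}  f _  f𝟎≡1 = [] , trans (ℤ.*-identityˡ (f [])) f𝟎≡1
normalise {suc k} f f± f𝟎≡1
  with normalise (f ∘ (false ∷_)) (f± ∘ (false ∷_)) f𝟎≡1 | f± (true ∷ 𝟎)
... | b , nb | inj₁ e = false ∷ b , nb ,
  cong₂ ℤ._*_ (sgn-𝟎ʳ b) e
... | b , nb | inj₂ e = true ∷ b , nb ,
  cong₂ ℤ._*_ (cong ℤ.-_ (sgn-𝟎ʳ b)) e

-- Three families are needed to close the recursion: a normalised function has a normalised `false`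
-- half, but its `true` half is prescribed only at its own origin; halving the latter again leaves
-- one half with no prescribed value. For `k = 4` the normalised family has 2 · 8 · 128 entries.
signSpectra spectraFrom1 normalisedSpectra : ℕ → List (List ℤ)
signSpectra zero    = (1ℤ ∷ []) ∷ (-1ℤ ∷ []) ∷ []
signSpectra (suc k) = cartesianProductWith butterfly (signSpectra k) (signSpectra k)
spectraFrom1 zero    = (1ℤ ∷ []) ∷ []
spectraFrom1 (suc k) = cartesianProductWith butterfly (spectraFrom1 k) (signSpectra k)
normalisedSpectra zero    = (1ℤ ∷ []) ∷ []
normalisedSpectra (suc k) = cartesianProductWith butterfly (normalisedSpectra k) (spectraFrom1 k)

∈-signSpectra : (f : Vec Bool k → ℤ) → (∀ u → IsSign (f u)) → spectrum f ∈ signSpectra k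
∈-signSpectra {zero} f f± with f± []
... | inj₁ e = here (cong (_∷ []) e)
... | inj₂ e = there (here (cong (_∷ []) e))
∈-signSpectra {suc k} f f± = subst (_∈ signSpectra (suc k)) (sym (spectrum-suc f))
  (∈-cartesianProductWith⁺ butterfly (∈-signSpectra _ (f± ∘ (false ∷_))) (∈-signSpectra _ (f± ∘ (true ∷_))))

∈-spectraFrom1 : (f : Vec Bool k → ℤ) → (∀ u → IsSign (f u)) → f 𝟎 ≡ 1ℤ → spectrum f ∈ spectraFrom1 k
∈-spectraFrom1 {zero}  f _  e = here (cong (_∷ []) e)
∈-spectraFrom1 {suc k} f f± e = subst (_∈ spectraFrom1 (suc k)) (sym (spectrum-suc f))
  (∈-cartesianProductWith⁺ butterfly (∈-spectraFrom1 _ (f± ∘ (false ∷_)) e) (∈-signSpectra _ (f± ∘ (true ∷_))))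

∈-normalisedSpectra : (f : Vec Bool k → ℤ) → (∀ u → IsSign (f u)) → Normalised f →
  spectrum f ∈ normalisedSpectra k
∈-normalisedSpectra {zero}  f _  e = here (cong (_∷ []) e)
∈-normalisedSpectra {suc k} f f± (nf , e) = subst (_∈ normalisedSpectra (suc k)) (sym (spectrum-suc f))
  (∈-cartesianProductWith⁺ butterfly (∈-normalisedSpectra _ (f± ∘ (false ∷_)) nf) (∈-spectraFrom1 _ (f± ∘ (true ∷_)) e))

insert : ℤ → List ℤ → List ℤ
insert x []       = x ∷ []
insert x (y ∷ ys) = if x ℤ.≤ᵇ y then x ∷ y ∷ ys else y ∷ insert x ys

sort : List ℤ → List ℤ
sort = foldr insert []

insert-↭ : ∀ x ys → insert x ys ↭ x ∷ ys
insert-↭ x []       = ↭-refl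
insert-↭ x (y ∷ ys) with x ℤ.≤ᵇ y
... | true  = ↭-refl
... | false = ↭-trans (prep y (insert-↭ x ys)) (swap y x ↭-refl)

-- The soundness of comparing sorted lists rests on this fact: equal results force the inputs to be
-- permutations of each other.
sort-↭ : ∀ xs → sort xs ↭ xs
sort-↭ []       = ↭-refl
sort-↭ (x ∷ xs) = ↭-trans (insert-↭ x (sort xs)) (prep x (sort-↭ xs))

doubled : List ℤ → List ℤ
doubled = map (+ 2 ℤ.*_)

normalisedSpectra₄ : All (λ s → sort s ∈ map (sort ∘ doubled) solutions) (normalisedSpectra 4)
normalisedSpectra₄ =
  -- The type of `_` evaluates to the unit type once the decision evaluates to `yes`, so type
  -- checking performs the exhaustive search.
  toWitness {a? = All.all? (λ s → sort s ∈? map (sort ∘ doubled) solutions) (normalisedSpectra 4)} _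

spectrum₄ : (f : Vec Bool 4 → ℤ) → (∀ u → IsSign (f u)) → f 𝟎 ≡ 1ℤ →
  ∃ λ T → T ∈ solutions × spectrum f ↭ doubled T
spectrum₄ f f± f𝟎≡1 with normalise f f± f𝟎≡1
... | b , nb
  with ∈-map⁻ (sort ∘ doubled) (All.lookup normalisedSpectra₄
         (∈-normalisedSpectra _ (λ u → *-isSign (sgn-isSign b u) (f± u)) nb))
... | T , T∈ , e = T , T∈ ,
  ↭-trans (↭-sym (spectrum-translate b f))
    (↭-trans (↭-sym (sort-↭ _)) (↭-trans (↭-reflexive e) (sort-↭ _)))

-- Sums over a finite field

sum-zero : (t : Fin n → ℤ) → (∀ i → t i ≡ 0ℤ) → sum t ≡ 0ℤ
sum-zero {n} t t≡0 = trans (sum-cong-≗ t≡0) (sum-replicate-zero n)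

sum-single : (t : Fin n → ℤ) (i : Fin n) → (∀ j → j ≢ i → t j ≡ 0ℤ) → sum t ≡ t i
sum-single {suc n} t i t≡0 = trans (sum-remove {i = i} t)
  (trans (cong (λ x → t i ℤ.+ x) (sum-zero _ (λ j → t≡0 (punchIn i j) (punchInᵢ≢i i j))))
    (ℤ.+-identityʳ (t i)))

sum-one : ∀ n → sum {n} (λ _ → 1ℤ) ≡ + n
sum-one zero    = refl
sum-one (suc n) = cong (λ x → 1ℤ ℤ.+ x) (sum-one n)

⟦_⟧ : {P : Set p} → Dec P → ℤ
⟦ d ⟧ = if does d then 1ℤ else 0ℤ

⟦⟧-yes : {P : Set p} (d : Dec P) → P → ⟦ d ⟧ ≡ 1ℤ
⟦⟧-yes (yes _) _  = refl
⟦⟧-yes (no ¬p) p′ = contradiction p′ ¬p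

⟦⟧-no : {P : Set p} (d : Dec P) → ¬ P → ⟦ d ⟧ ≡ 0ℤ
⟦⟧-no (yes p′) ¬p = contradiction p′ ¬p
⟦⟧-no (no _)   _  = refl

⟦⟧-cong : {P : Set a} {Q : Set b} (d : Dec P) (e : Dec Q) → (P → Q) → (Q → P) → ⟦ d ⟧ ≡ ⟦ e ⟧
⟦⟧-cong d (yes q) _  to = ⟦⟧-yes d (to q)
⟦⟧-cong d (no ¬q) to _  = ⟦⟧-no d (¬q ∘ to)

length-filter-tabulate : {A : Set a} {P : Unary.Pred A p} (P? : Unary.Decidable P) (f : Fin n → A) →
  + length (filter P? (tabulate f)) ≡ sum (λ i → ⟦ P? (f i) ⟧)
length-filter-tabulate {n = zero}  P? f = refl
length-filter-tabulate {n = suc n} P? f with does (P? (f zero))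
... | true  = cong (λ x → 1ℤ ℤ.+ x) (length-filter-tabulate P? (f ∘ suc))
... | false = trans (length-filter-tabulate P? (f ∘ suc)) (sym (ℤ.+-identityˡ _))

module FieldSum (K : FiniteField c ℓ q) where
  open FiniteField K renaming (trans to trans≈; sym to sym≈; refl to refl≈)
  open Inverse enumeration public using () renaming (to to index; from to element)

  element-index : ∀ x → element (index x) ≈ x
  element-index = Inverse.strictlyInverseʳ enumeration

  index-element : ∀ i → index (element i) ≡ i
  index-element = Inverse.strictlyInverseˡ enumeration

  index-cong : ∀ {x y} → x ≈ y → index x ≡ index y
  index-cong = Inverse.to-cong enumeration

  index-injective : ∀ {x y} → index x ≡ index y → x ≈ y
  index-injective {x} {y} e =
    trans≈ (sym≈ (element-index x)) (trans≈ (reflexive (cong element e)) (element-index y))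

  Respects : (Carrier → ℤ) → Set _
  Respects f = ∀ {x y} → x ≈ y → f x ≡ f y

  ∑ : (Carrier → ℤ) → ℤ
  ∑ f = sum (f ∘ element)

  ∑-cong : ∀ {f g} → f ≗ g → ∑ f ≡ ∑ g
  ∑-cong f≗g = sum-cong-≗ (f≗g ∘ element)

  translation : Carrier → Permutation q q
  translation a = permutation (λ i → index (a + element i)) (λ i → index (- a + element i))
    (λ i → trans (index-cong (trans≈ (+-congˡ (element-index _)) (cancel a (- a) (element i) (-‿inverseʳ a)))) (index-element i))
    (λ i → trans (index-cong (trans≈ (+-congˡ (element-index _)) (cancel (- a) a (element i) (-‿inverseˡ a)))) (index-element i))
    where
    cancel : ∀ x y z → x + y ≈ 0# → x + (y + z) ≈ z
    cancel x y z e = trans≈ (sym≈ (+-assoc x y z)) (trans≈ (+-congʳ e) (+-identityˡ z))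

  ∑-translate : ∀ {f} → Respects f → ∀ a → ∑ (λ x → f (a + x)) ≡ ∑ f
  ∑-translate {f} f-resp a = sym (trans (sum-permute (f ∘ element) (translation a))
    (sum-cong-≗ {q} (λ i → f-resp (element-index (a + element i)))))

  card≡∑ : ∀ {p} {P : Unary.Pred Carrier p} (P? : Unary.Decidable P) → + card P? ≡ ∑ (λ x → ⟦ P? x ⟧)
  card≡∑ P? = length-filter-tabulate P? element

  ∑-indicator : ∀ {f} → Respects f → ∀ y → ∑ (λ b → f b ℤ.* ⟦ y ≟ b ⟧) ≡ f y
  ∑-indicator {f} f-resp y = trans (sum-single _ (index y) off) on
    where
    on : f (element (index y)) ℤ.* ⟦ y ≟ element (index y) ⟧ ≡ f y
    on = trans (cong (f (element (index y)) ℤ.*_) (⟦⟧-yes (y ≟ _) (sym≈ (element-index y))))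
      (trans (ℤ.*-identityʳ _) (f-resp (element-index y)))
    off : ∀ i → i ≢ index y → f (element i) ℤ.* ⟦ y ≟ element i ⟧ ≡ 0ℤ
    off i i≢ = trans (cong (f (element i) ℤ.*_) (⟦⟧-no (y ≟ _) (λ e → i≢ (sym (trans (index-cong e) (index-element i))))))
      (ℤ.*-zeroʳ (f (element i)))

module _ (L : FiniteField c ℓ q) where
  open FiniteField L renaming (trans to trans≈; sym to sym≈; refl to refl≈)
  open FieldSum L
  private
    module M = MonoidSum +-commutativeMonoid
  open Mult +-monoid using () renaming (_×_ to _·_)
  open RingProperties ring using (+-cancelˡ)

  -- Translation by `x` permutes the elements, so adding `q · x` to the sum of all elements leaves
  -- it unchanged.
  order-·≈0 : ∀ x → q · x ≈ 0#
  order-·≈0 x = +-cancelˡ (M.sum element) _ _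
    (trans≈ (trans≈ (+-congˡ (sym≈ (M.sum-replicate q)))
      (trans≈ (sym≈ (M.∑-distrib-+ element (λ _ → x)))
        (trans≈ (M.sum-cong-≋ {q} (λ i → trans≈ (+-comm (element i) x) (sym≈ (element-index (x + element i)))))
          (sym≈ (M.sum-permute element (translation x))))))
      (sym≈ (+-identityʳ _)))

Fin↔Vec : ∀ k → Fin (2 ^ k) ↔ Vec Bool k
Fin↔Vec zero    = mk↔ₛ′ (λ _ → []) (λ _ → zero) (λ { [] → refl }) (λ { zero → refl })
Fin↔Vec (suc k) = ↔-trans (*↔× {2}) (↔-trans (2↔Bool ×-↔ Fin↔Vec k)
  (mk↔ₛ′ (λ (b , v) → b ∷ v) (λ { (b ∷ v) → b , v }) (λ { (b ∷ v) → refl }) (λ { (b , v) → refl })))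

-- Coordinates on a field with 2ᵐ elements

module VectorSpace (m : ℕ) (L : FiniteField c ℓ (2 ^ m)) where
  open FiniteField L renaming (trans to trans≈; sym to sym≈; refl to refl≈)
  open FieldSum L
  open Mult +-monoid using (×-assocˡ) renaming (_×_ to _·_)

  -- 2ᵐ · 1 = 0, whereas doubling would be injective if some x + x were invertible.
  characteristic-2 : ∀ x → x + x ≈ 0#
  characteristic-2 x = decidable-stable (x + x ≟ 0#) (λ x+x≉0 →
    0≉1 (sym≈ (power-torsionfree (doubling-torsionfree x+x≉0) m (order-·≈0 L 1#))))
    where
    doubling-torsionfree : ¬ x + x ≈ 0# → ∀ {y} → y + y ≈ 0# → y ≈ 0#
    doubling-torsionfree x+x≉0 {y} y+y≈0 with invertible (x + x) x+x≉0
    ... | s , xs = trans≈ (sym≈ (*-identityˡ y)) (trans≈ (*-congʳ (sym≈ xs))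
      (trans≈ (*-congʳ (*-comm (x + x) s)) (trans≈ (*-assoc s (x + x) y)
        -- Both `(x + x) * y` and `x * (y + y)` expand to `x * y + x * y`, so the factor multiplied
        -- by `s` vanishes.
        (trans≈ (*-congˡ (trans≈ (distribʳ y x x) (trans≈ (sym≈ (distribˡ x y y))
          (trans≈ (*-congˡ y+y≈0) (zeroʳ x))))) (zeroʳ s)))))
    power-torsionfree : (∀ {y} → y + y ≈ 0# → y ≈ 0#) → ∀ j {y} → (2 ^ j) · y ≈ 0# → y ≈ 0#
    power-torsionfree tf zero    {y} e = trans≈ (sym≈ (+-identityʳ y)) e
    power-torsionfree tf (suc j) {y} e = power-torsionfree tf j (tf
      (trans≈ (+-congˡ (sym≈ (+-identityʳ _))) (trans≈ (×-assocˡ y 2 (2 ^ j)) e)))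

  -- Amounts to `k` elements independent over 𝔽₂, namely the images of the basis vectors. The only
  -- scalars are 0 and 1, so additivity is linearity.
  record AdditiveEmbedding (k : ℕ) : Set (c ⊔ ℓ) where
    field
      φ   : Vec Bool k → Carrier
      φ-⊕ : ∀ u v → φ (u ⊕ v) ≈ φ u + φ v
      φ-injective : ∀ {u v} → φ u ≈ φ v → u ≡ v

  +-cancel-char2 : ∀ x y → x + (x + y) ≈ y
  +-cancel-char2 x y = trans≈ (sym≈ (+-assoc x x y)) (trans≈ (+-congʳ (characteristic-2 x)) (+-identityˡ y))

  module _ (E : AdditiveEmbedding k) where
    open AdditiveEmbedding E

    InImage : Carrier → Set _
    InImage β = ∃ λ v → φ v ≈ β

    inImage? : ∀ β → Dec (InImage β)
    inImage? β = map′ Any.satisfied (λ (v , e) → lose (∈-cube v) e) (Any.any? (λ v → φ v ≟ β) (cube k))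

    module _ {β : Carrier} (β∉ : ¬ InImage β) where
      -- Adjoins `β` as a further basis element. A collision between the two halves,
      -- `φ u ≈ β + φ v`, would put `β` itself in the image as `φ (v ⊕ u)`.
      extend : AdditiveEmbedding (suc k)
      extend = record { φ = φ⁺ ; φ-⊕ = φ⁺-⊕ ; φ-injective = φ⁺-injective }
        where
        φ⁺ : Vec Bool (suc k) → Carrier
        φ⁺ (false ∷ v) = φ v
        φ⁺ (true  ∷ v) = β + φ v
        φ⁺-⊕ : ∀ u v → φ⁺ (u ⊕ v) ≈ φ⁺ u + φ⁺ v
        φ⁺-⊕ (false ∷ u) (false ∷ v) = φ-⊕ u v
        φ⁺-⊕ (false ∷ u) (true  ∷ v) = trans≈ (+-congˡ (trans≈ (φ-⊕ u v) (+-comm _ _)))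
          (trans≈ (sym≈ (+-assoc β (φ v) (φ u))) (+-comm _ _))
        φ⁺-⊕ (true  ∷ u) (false ∷ v) = trans≈ (+-congˡ (φ-⊕ u v)) (sym≈ (+-assoc β (φ u) (φ v)))
        φ⁺-⊕ (true  ∷ u) (true  ∷ v) = trans≈ (φ-⊕ u v) (sym≈ (trans≈ (+-congʳ (+-comm β (φ u)))
          (trans≈ (+-assoc (φ u) β (β + φ v)) (+-congˡ (+-cancel-char2 β (φ v))))))
        separated : ∀ u v → ¬ φ u ≈ β + φ v
        separated u v e = β∉ (v ⊕ u , trans≈ (φ-⊕ v u) (trans≈ (+-congˡ (trans≈ e (+-comm β (φ v)))) (+-cancel-char2 (φ v) β)))
        φ⁺-injective : ∀ {u v} → φ⁺ u ≈ φ⁺ v → u ≡ v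
        φ⁺-injective {false ∷ u} {false ∷ v} e = cong (false ∷_) (φ-injective e)
        φ⁺-injective {false ∷ u} {true  ∷ v} e = contradiction e (separated u v)
        φ⁺-injective {true  ∷ u} {false ∷ v} e = contradiction (sym≈ e) (separated v u)
        φ⁺-injective {true  ∷ u} {true  ∷ v} e = cong (true ∷_) (φ-injective
          (trans≈ (sym≈ (+-cancel-char2 β (φ u))) (trans≈ (+-congˡ e) (+-cancel-char2 β (φ v)))))

  trivialEmbedding : AdditiveEmbedding 0
  trivialEmbedding = record
    { φ = λ _ → 0#
    ; φ-⊕ = λ _ _ → sym≈ (+-identityˡ 0#)
    ; φ-injective = λ { {[]} {[]} _ → refl }
    }

  -- Together with the opposite bound for surjective embeddings, this replaces dimension by
  -- counting: an embedding with `k < m` misses an element and can be extended, while one with `k`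
  -- equal to `m` that missed an element would extend beyond the size of the field.
  embedding⇒≤ : AdditiveEmbedding k → 2 ^ k ℕ.≤ 2 ^ m
  embedding⇒≤ {k} E = injective⇒≤ {f = λ i → index (φ (Inverse.to (Fin↔Vec k) i))}
    (Injection.injective (Inverse⇒Injection (Fin↔Vec k)) ∘ φ-injective ∘ index-injective)
    where open AdditiveEmbedding E

  surjective⇒≥ : (E : AdditiveEmbedding k) → (∀ β → InImage E β) → 2 ^ m ℕ.≤ 2 ^ k
  surjective⇒≥ {k} E surj = injective⇒≤ {f = λ i → Inverse.from (Fin↔Vec k) (proj₁ (surj (element i)))}
    (λ {i} {j} e → trans (sym (index-element i)) (trans (index-cong
      (trans≈ (sym≈ (proj₂ (surj (element i))))
        (trans≈ (reflexive (cong φ (Injection.injective (Inverse⇒Injection (↔-sym (Fin↔Vec k))) e)))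
          (proj₂ (surj (element j)))))) (index-element j)))
    where open AdditiveEmbedding E

  surjective? : (E : AdditiveEmbedding k) → (∃ λ β → ¬ InImage E β) ⊎ (∀ β → InImage E β)
  surjective? E with all? (λ i → inImage? E (element i))
  ... | yes every = inj₂ (λ β → proj₁ (every (index β)) , trans≈ (proj₂ (every (index β))) (element-index β))
  ... | no ¬every with ¬∀⟶∃¬ (2 ^ m) _ (λ i → inImage? E (element i)) ¬every
  ...   | i , ∉ = inj₁ (element i , ∉)

  -- Later arguments use only the fields of the embedding and its surjectivity, so its construction
  -- is kept opaque.
  abstract
    embedding : k ℕ.≤ m → AdditiveEmbedding k
    embedding {zero}  _   = trivialEmbedding
    embedding {suc k} k<m with embedding (ℕ.<⇒≤ k<m)
    ... | E with surjective? E
    ...   | inj₁ (β , β∉) = extend E β∉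
    ...   | inj₂ surj     = contradiction (surjective⇒≥ E surj) (ℕ.<⇒≱ (ℕ.^-monoʳ-< 2 (ℕ.s≤s (ℕ.s≤s ℕ.z≤n)) k<m))

    embedding-surjective : (E : AdditiveEmbedding m) → ∀ β → InImage E β
    embedding-surjective E with surjective? E
    ... | inj₁ (β , β∉) = contradiction (embedding⇒≤ (extend E β∉))
                            (ℕ.<⇒≱ (ℕ.^-monoʳ-< 2 (ℕ.s≤s (ℕ.s≤s ℕ.z≤n)) (ℕ.n<1+n m)))
    ... | inj₂ surj     = surj

-- Character sums

module _ (K : FiniteField c₁ ℓ₁ q) (L : FiniteField c₂ ℓ₂ r) where
  private
    module K where
      open FiniteField K public
      open FieldSum K public
    module L where
      open FiniteField L public
      open FieldSum L public

  ∑-fibres : ∀ {f} → L.Respects f → (g : K.Carrier → L.Carrier) →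
    K.∑ (f ∘ g) ≡ L.∑ (λ b → f b ℤ.* + K.card (λ x → g x L.≟ b))
  ∑-fibres {f} f-resp g = begin
    K.∑ (f ∘ g)                                          ≡⟨ K.∑-cong (λ x → L.∑-indicator f-resp (g x)) ⟨
    K.∑ (λ x → L.∑ (λ b → f b ℤ.* ⟦ g x L.≟ b ⟧))        ≡⟨ ∑-comm {q} {r} _ ⟩
    L.∑ (λ b → K.∑ (λ x → f b ℤ.* ⟦ g x L.≟ b ⟧))        ≡⟨ L.∑-cong (λ b → *-distribˡ-sum {q} (f b) (λ i → ⟦ g (K.element i) L.≟ b ⟧)) ⟨
    L.∑ (λ b → f b ℤ.* K.∑ (λ x → ⟦ g x L.≟ b ⟧))        ≡⟨ L.∑-cong (λ b → cong (f b ℤ.*_) (K.card≡∑ (λ x → g x L.≟ b))) ⟨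
    L.∑ (λ b → f b ℤ.* + K.card (λ x → g x L.≟ b))       ∎
    where open ≡-Reasoning

-- A nontrivial real character of the additive group. Nontriviality is carried by an explicit
-- element of value -1, which is what the vanishing of the character sum translates by.
record Character (L : FiniteField c ℓ r) : Set (c ⊔ ℓ) where
  open FiniteField L
  field
    χ         : Carrier → ℤ
    χ-cong    : ∀ {x y} → x ≈ y → χ x ≡ χ y
    χ-isSign  : ∀ x → IsSign (χ x)
    χ-+       : ∀ x y → χ (x + y) ≡ χ x ℤ.* χ y
    element₋₁ : Carrier
    χ-₋₁      : χ element₋₁ ≡ -1ℤ

i≡-i⇒i≡0 : ∀ i → i ≡ ℤ.- i → i ≡ 0ℤ
i≡-i⇒i≡0 (+ zero) _ = refl

module _ {L : FiniteField c ℓ r} (X : Character L) where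
  open FiniteField L hiding (sym; trans; refl)
  open FieldSum L
  open Character X

  ∑-character : ∑ χ ≡ 0ℤ
  ∑-character = i≡-i⇒i≡0 (∑ χ) (begin
    ∑ χ                                   ≡⟨ ∑-translate χ-cong element₋₁ ⟨
    ∑ (λ x → χ (element₋₁ + x))           ≡⟨ ∑-cong (λ x → trans (χ-+ element₋₁ x) (cong (ℤ._* χ x) χ-₋₁)) ⟩
    ∑ (λ x → -1ℤ ℤ.* χ x)                 ≡⟨ *-distribˡ-sum {r} -1ℤ _ ⟨
    -1ℤ ℤ.* ∑ χ                           ≡⟨ ℤ.-1*i≡-i (∑ χ) ⟩
    ℤ.- ∑ χ                               ∎)
    where open ≡-Reasoning

  -- A sign is its own inverse, so a product of character values is also their quotient.
  χ-difference : ∀ x y → χ x ℤ.* χ y ≡ χ (y - x)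
  χ-difference x y = begin
    χ x ℤ.* χ y                     ≡⟨ cong (χ x ℤ.*_) (χ-cong (y≈[y-x]+x)) ⟩
    χ x ℤ.* χ ((y - x) + x)         ≡⟨ cong (χ x ℤ.*_) (χ-+ (y - x) x) ⟩
    χ x ℤ.* (χ (y - x) ℤ.* χ x)     ≡⟨ lemma (χ x) (χ (y - x)) ⟩
    χ x ℤ.* χ x ℤ.* χ (y - x)       ≡⟨ cong (ℤ._* χ (y - x)) (isSign-square (χ-isSign x)) ⟩
    1ℤ ℤ.* χ (y - x)                ≡⟨ ℤ.*-identityˡ _ ⟩
    χ (y - x)                       ∎
    where
    open ≡-Reasoning
    open FiniteField L using () renaming (sym to sym≈; trans to trans≈)
    y≈[y-x]+x : y ≈ (y - x) + x
    y≈[y-x]+x = sym≈ (trans≈ (+-assoc y (- x) x) (trans≈ (+-congˡ (-‿inverseˡ x)) (+-identityʳ y)))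
    lemma : ∀ s t → s ℤ.* (t ℤ.* s) ≡ s ℤ.* s ℤ.* t
    lemma = solve-∀

  χ-0 : ∀ {x} → x ≈ 0# → χ x ≡ 1ℤ
  χ-0 {x} x≈0 = begin
    χ x                ≡⟨ χ-cong (trans≈ x≈0 (sym≈ (-‿inverseʳ x))) ⟩
    χ (x - x)          ≡⟨ χ-difference x x ⟨
    χ x ℤ.* χ x        ≡⟨ isSign-square (χ-isSign x) ⟩
    1ℤ                 ∎
    where
    open ≡-Reasoning
    open FiniteField L using () renaming (sym to sym≈; trans to trans≈)

module _ (K : FiniteField c₁ ℓ₁ q) (L : FiniteField c₂ ℓ₂ r)
         (F : Func (FiniteField.≈-setoid K) (FiniteField.≈-setoid L)) where
  private
    module K where
      open FiniteField K public
      open FieldSum K public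
    module L where
      open FiniteField L public
      open FieldSum L public
  open Func F using (to) renaming (cong to to-cong)

  derivative : K.Carrier → K.Carrier → L.Carrier
  derivative a x = to (x K.+ a) L.- to x

  module _ (balanced : ∀ a → ¬ a K.≈ K.0# → ∀ b b′ →
              K.card (λ x → derivative a x L.≟ b) ≡ K.card (λ x → derivative a x L.≟ b′))
           (X : Character L) where
    open Character X
    open ≡-Reasoning

    ∑-derivative : ∀ a → K.∑ (χ ∘ derivative a) ≡ + q ℤ.* ⟦ K.0# K.≟ a ⟧
    ∑-derivative a with K.0# K.≟ a
    ... | yes 0≈a = begin
      K.∑ (χ ∘ derivative a)   ≡⟨ K.∑-cong (λ x → χ-0 X (vanishes x)) ⟩
      K.∑ (λ _ → 1ℤ)           ≡⟨ sum-one q ⟩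
      + q                      ≡⟨ ℤ.*-identityʳ (+ q) ⟨
      + q ℤ.* 1ℤ               ≡⟨ cong (+ q ℤ.*_) (⟦⟧-yes (K.0# K.≟ a) 0≈a) ⟨
      + q ℤ.* ⟦ K.0# K.≟ a ⟧   ∎
      where
      vanishes : ∀ x → derivative a x L.≈ L.0#
      vanishes x = L.trans
        (L.+-congʳ (to-cong (K.trans (K.+-congˡ (K.sym 0≈a)) (K.+-identityʳ x))))
        (L.-‿inverseʳ (to x))
    ... | no 0≉a = begin
      K.∑ (χ ∘ derivative a)                                              ≡⟨ ∑-fibres K L χ-cong (derivative a) ⟩
      L.∑ (λ b → χ b ℤ.* + K.card (λ x → derivative a x L.≟ b))           ≡⟨ L.∑-cong (λ b → cong (λ d → χ b ℤ.* + d) (balanced a (0≉a ∘ K.sym) b L.0#)) ⟩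
      L.∑ (λ b → χ b ℤ.* d₀)                                              ≡⟨ *-distribʳ-sum {r} d₀ _ ⟨
      L.∑ χ ℤ.* d₀                                                        ≡⟨ cong (ℤ._* d₀) (∑-character X) ⟩
      0ℤ                                                                  ≡⟨ ℤ.*-zeroʳ (+ q) ⟨
      + q ℤ.* 0ℤ                                                          ≡⟨ cong (+ q ℤ.*_) (⟦⟧-no (K.0# K.≟ a) 0≉a) ⟨
      + q ℤ.* ⟦ K.0# K.≟ a ⟧                                              ∎
      where
      d₀ = + K.card (λ x → derivative a x L.≟ L.0#)

    walsh : ℤ
    walsh = K.∑ (χ ∘ to)

    walsh-square : walsh ℤ.* walsh ≡ + q
    walsh-square = begin
      walsh ℤ.* walsh                                             ≡⟨ *-distribʳ-sum {q} walsh _ ⟩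
      -- The second factor is reindexed separately for each `x`, its variable becoming `x + a`, so
      -- that the double sum runs over differences `a`.
      K.∑ (λ x → χ (to x) ℤ.* walsh)                              ≡⟨ K.∑-cong (λ x → cong (χ (to x) ℤ.*_) (K.∑-translate (λ e → χ-cong (to-cong e)) x)) ⟨
      K.∑ (λ x → χ (to x) ℤ.* K.∑ (λ a → χ (to (x K.+ a))))       ≡⟨ K.∑-cong (λ x → *-distribˡ-sum {q} (χ (to x)) (λ i → χ (to (x K.+ K.element i)))) ⟩
      K.∑ (λ x → K.∑ (λ a → χ (to x) ℤ.* χ (to (x K.+ a))))       ≡⟨ K.∑-cong (λ x → K.∑-cong (λ a → χ-difference X (to x) (to (x K.+ a)))) ⟩
      K.∑ (λ x → K.∑ (λ a → χ (derivative a x)))                  ≡⟨ ∑-comm {q} {q} _ ⟩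
      K.∑ (λ a → K.∑ (χ ∘ derivative a))                          ≡⟨ K.∑-cong ∑-derivative ⟩
      K.∑ (λ a → + q ℤ.* ⟦ K.0# K.≟ a ⟧)                          ≡⟨ K.∑-indicator (λ _ → refl) K.0# ⟩
      + q                                                         ∎

-- Square roots of powers of 2, and powers of 2 in ℚ

-- Descent by a factor 4: for positive `n` the root is even, and halving it lowers the exponent by
-- 2. The descent cannot pass through exponent 1, since 4 does not divide 2.
square-power-of-2 : ∀ n {w} → w ℕ.* w ≡ 2 ^ n → ∃ λ h → n ≡ h ℕ.* 2 × w ≡ 2 ^ h
square-power-of-2 zero {w} e = 0 , refl , ℕ.m*n≡1⇒m≡1 w w e
square-power-of-2 (suc n) {w} e with even
  where
  even : 2 ∣ w
  even with euclidsLemma w w prime[2] (divides (2 ^ n) (trans e (ℕ.*-comm 2 (2 ^ n))))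
  ... | inj₁ d = d
  ... | inj₂ d = d
square-power-of-2 (suc zero) e | divides w refl =
  contradiction (ℕ.m*n≡1⇒m≡1 2 (w ℕ.* w) (ℕ.*-cancelˡ-≡ _ _ 2 (trans (lemma w) e))) λ ()
  where
  lemma : ∀ w → 2 ℕ.* (2 ℕ.* (w ℕ.* w)) ≡ (w ℕ.* 2) ℕ.* (w ℕ.* 2)
  lemma = ℕ-RingSolver.solve-∀
square-power-of-2 (suc (suc n)) e | divides w refl
  with square-power-of-2 n {w} (ℕ.*-cancelˡ-≡ _ _ 4 (trans (lemma w) (trans e (sym (ℕ.*-assoc 2 2 (2 ^ n))))))
  where
  lemma : ∀ w → 4 ℕ.* (w ℕ.* w) ≡ (w ℕ.* 2) ℕ.* (w ℕ.* 2)
  lemma = ℕ-RingSolver.solve-∀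
... | h , refl , refl = suc h , refl , ℕ.*-comm (2 ^ h) 2

square⇒even : ∀ w → w ℤ.* w ≡ + (2 ^ n) → ∃ λ h → n ≡ h ℕ.* 2
square⇒even {n = n} w e =
  let h , n≡2h , _ = square-power-of-2 n {∣ w ∣} (trans (sym (ℤ.abs-* w w)) (cong ∣_∣ e))
  in h , n≡2h

-- The exponent `h` is an argument so that one and the same `h` serves all the values `W u`.
square-root : ∀ h w → n ≡ h ℕ.* 2 → w ℤ.* w ≡ + (2 ^ n) → ∃ λ s → IsSign s × w ≡ + (2 ^ h) ℤ.* s
square-root {n = n} h w n≡2h e with square-power-of-2 n {∣ w ∣} (trans (sym (ℤ.abs-* w w)) (cong ∣_∣ e))
... | h′ , n≡2h′ , ∣w∣≡ with ℕ.*-cancelʳ-≡ h h′ 2 (trans (sym n≡2h) n≡2h′)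
... | refl with ℤ.+∣i∣≡i⊎+∣i∣≡-i w
...   | inj₁ +∣w∣≡w = 1ℤ , inj₁ refl ,
  trans (sym +∣w∣≡w) (trans (cong +_ ∣w∣≡) (sym (ℤ.*-identityʳ _)))
...   | inj₂ +∣w∣≡-w = -1ℤ , inj₂ refl , (begin
  w                    ≡⟨ ℤ.neg-involutive w ⟨
  ℤ.- ℤ.- w            ≡⟨ cong ℤ.-_ +∣w∣≡-w ⟨
  ℤ.- + ∣ w ∣          ≡⟨ cong (λ x → ℤ.- + x) ∣w∣≡ ⟩
  ℤ.- + (2 ^ h)        ≡⟨ ℤ.-1*i≡-i (+ (2 ^ h)) ⟨
  -1ℤ ℤ.* + (2 ^ h)    ≡⟨ ℤ.*-comm -1ℤ (+ (2 ^ h)) ⟩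
  + (2 ^ h) ℤ.* -1ℤ    ∎)
  where open ≡-Reasoning

fromℤ-injective : ∀ {i j} → fromℤ i ≡ fromℤ j → i ≡ j
fromℤ-injective {i} {j} e with ℚ.fromℚᵘ-injective {ℚᵘ.mkℚᵘ i 0} {ℚᵘ.mkℚᵘ j 0} e
... | ℚᵘ.*≡* e′ = trans (sym (ℤ.*-identityʳ i)) (trans e′ (ℤ.*-identityʳ j))

fromℤ-+ : ∀ i j → fromℤ (i ℤ.+ j) ≡ fromℤ i ℚ.+ fromℤ j
fromℤ-+ i j = ℚ.toℚᵘ-injective (begin
  ℚ.toℚᵘ (fromℤ (i ℤ.+ j))                    ≈⟨ ℚ.toℚᵘ-fromℚᵘ (ℚᵘ.mkℚᵘ (i ℤ.+ j) 0) ⟩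
  ℚᵘ.mkℚᵘ (i ℤ.+ j) 0                         ≈⟨ ℚᵘ.*≡* (cong (ℤ._* 1ℤ) (cong₂ ℤ._+_ (sym (ℤ.*-identityʳ i)) (sym (ℤ.*-identityʳ j)))) ⟩
  ℚᵘ.mkℚᵘ i 0 ℚᵘ.+ ℚᵘ.mkℚᵘ j 0                ≈⟨ ℚᵘ.+-cong (ℚ.toℚᵘ-fromℚᵘ (ℚᵘ.mkℚᵘ i 0)) (ℚ.toℚᵘ-fromℚᵘ (ℚᵘ.mkℚᵘ j 0)) ⟨
  ℚ.toℚᵘ (fromℤ i) ℚᵘ.+ ℚ.toℚᵘ (fromℤ j)      ≈⟨ ℚ.toℚᵘ-homo-+ (fromℤ i) (fromℤ j) ⟨
  ℚ.toℚᵘ (fromℤ i ℚ.+ fromℤ j)                ∎)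
  where open import Relation.Binary.Reasoning.Setoid ℚᵘ.≃-setoid

fromℤ-* : ∀ i j → fromℤ (i ℤ.* j) ≡ fromℤ i ℚ.* fromℤ j
fromℤ-* i j = ℚ.toℚᵘ-injective (begin
  ℚ.toℚᵘ (fromℤ (i ℤ.* j))                    ≈⟨ ℚ.toℚᵘ-fromℚᵘ (ℚᵘ.mkℚᵘ (i ℤ.* j) 0) ⟩
  ℚᵘ.mkℚᵘ i 0 ℚᵘ.* ℚᵘ.mkℚᵘ j 0                ≈⟨ ℚᵘ.*-cong (ℚ.toℚᵘ-fromℚᵘ (ℚᵘ.mkℚᵘ i 0)) (ℚ.toℚᵘ-fromℚᵘ (ℚᵘ.mkℚᵘ j 0)) ⟨
  ℚ.toℚᵘ (fromℤ i) ℚᵘ.* ℚ.toℚᵘ (fromℤ j)      ≈⟨ ℚ.toℚᵘ-homo-* (fromℤ i) (fromℤ j) ⟨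
  ℚ.toℚᵘ (fromℤ i ℚ.* fromℤ j)                ∎)
  where open import Relation.Binary.Reasoning.Setoid ℚᵘ.≃-setoid

-- For `k` below 4 the power is a proper fraction and the identity holds by evaluation; from 4 on
-- the exponent reduces to a natural number.
2^[k-4]*16 : ∀ k → (2^ (+ k ℤ.- + 4)) ℚ.* fromℤ (+ 16) ≡ fromℤ (+ (2 ^ k))
2^[k-4]*16 0 = refl
2^[k-4]*16 1 = refl
2^[k-4]*16 2 = refl
2^[k-4]*16 3 = refl
2^[k-4]*16 (suc (suc (suc (suc k)))) = trans (sym (fromℤ-* (+ (2 ^ k)) (+ 16)))
  (cong fromℤ (trans (sym (ℤ.pos-* (2 ^ k) 16)) (cong +_ (trans (ℕ.*-comm (2 ^ k) 16) (sym (ℕ.^-distribˡ-+-* 2 4 k))))))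

*16-injective : ∀ {x y : ℚ} → x ℚ.* fromℤ (+ 16) ≡ y ℚ.* fromℤ (+ 16) → x ≡ y
*16-injective {x} {y} e = begin
  x                                              ≡⟨ undo x ⟨
  x ℚ.* fromℤ (+ 16) ℚ.* (+ 1 ℚ./ 16)            ≡⟨ cong (ℚ._* (+ 1 ℚ./ 16)) e ⟩
  y ℚ.* fromℤ (+ 16) ℚ.* (+ 1 ℚ./ 16)            ≡⟨ undo y ⟩
  y                                              ∎
  where
  open ≡-Reasoning
  undo : ∀ z → z ℚ.* fromℤ (+ 16) ℚ.* (+ 1 ℚ./ 16) ≡ z
  undo z = trans (ℚ.*-assoc z _ _) (ℚ.*-identityʳ z)

-- preimageSize n t is sizeFromSpectrum n (+ 2 ℤ.* t).
sizeFromSpectrum : ℕ → ℤ → ℚ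
sizeFromSpectrum n s = 2^ (+ n ℤ.- + 4) ℚ.+ 2^ (+ (n ℕ./ 2) ℤ.- + 4) ℚ.* fromℤ (s ℤ.- 1ℤ)

sizeFromSpectrum-unique : ∀ {n} h s X → n ≡ h ℕ.* 2 →
  + 16 ℤ.* + X ≡ + (2 ^ n) ℤ.+ + (2 ^ h) ℤ.* (s ℤ.- 1ℤ) → fromℤ (+ X) ≡ sizeFromSpectrum n s
-- With `n` equal to `h * 2`, the truncated quotient `n / 2` in the definition is exactly `h`.
sizeFromSpectrum-unique h s X refl e rewrite m*n/n≡m h 2 {{_}} = *16-injective (begin
  fromℤ (+ X) ℚ.* sixteen
    ≡⟨ fromℤ-* (+ X) (+ 16) ⟨
  fromℤ (+ X ℤ.* + 16)
    ≡⟨ cong fromℤ (trans (ℤ.*-comm (+ X) (+ 16)) e) ⟩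
  fromℤ (+ (2 ^ (h ℕ.* 2)) ℤ.+ + (2 ^ h) ℤ.* (s ℤ.- 1ℤ))
    ≡⟨ fromℤ-+ (+ (2 ^ (h ℕ.* 2))) (+ (2 ^ h) ℤ.* (s ℤ.- 1ℤ)) ⟩
  fromℤ (+ (2 ^ (h ℕ.* 2))) ℚ.+ fromℤ (+ (2 ^ h) ℤ.* (s ℤ.- 1ℤ))
    ≡⟨ cong₂ ℚ._+_ (sym (2^[k-4]*16 (h ℕ.* 2)))
         (trans (fromℤ-* (+ (2 ^ h)) (s ℤ.- 1ℤ)) (cong (ℚ._* t) (sym (2^[k-4]*16 h)))) ⟩
  u ℚ.* sixteen ℚ.+ v ℚ.* sixteen ℚ.* t
    ≡⟨ cong (λ x → u ℚ.* sixteen ℚ.+ x) (trans (ℚ.*-assoc v sixteen t)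
         (trans (cong (v ℚ.*_) (ℚ.*-comm sixteen t)) (sym (ℚ.*-assoc v t sixteen)))) ⟩
  u ℚ.* sixteen ℚ.+ v ℚ.* t ℚ.* sixteen
    ≡⟨ ℚ.*-distribʳ-+ sixteen u (v ℚ.* t) ⟨
  (u ℚ.+ v ℚ.* t) ℚ.* sixteen ∎)
  where
  open ≡-Reasoning
  sixteen t u v : ℚ
  sixteen = fromℤ (+ 16)
  t = fromℤ (s ℤ.- 1ℤ)
  u = 2^ (+ (h ℕ.* 2) ℤ.- + 4)
  v = 2^ (+ h ℤ.- + 4)

-- Preimage sizes of a bent function

module Coordinates (m : ℕ) (L : FiniteField c ℓ (2 ^ m)) where
  open FiniteField L renaming (trans to trans≈; sym to sym≈; refl to refl≈)
  open FieldSum L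
  open VectorSpace m L
  open AdditiveEmbedding (embedding ℕ.≤-refl) public

  ψ : Carrier → Vec Bool m
  ψ β = proj₁ (embedding-surjective (embedding ℕ.≤-refl) β)

  φ-ψ : ∀ β → φ (ψ β) ≈ β
  φ-ψ β = proj₂ (embedding-surjective (embedding ℕ.≤-refl) β)

  ψ-cong : ∀ {x y} → x ≈ y → ψ x ≡ ψ y
  ψ-cong {x} {y} e = φ-injective (trans≈ (φ-ψ x) (trans≈ e (sym≈ (φ-ψ y))))

  ψ-φ : ∀ v → ψ (φ v) ≡ v
  ψ-φ v = φ-injective (φ-ψ (φ v))

  ψ-+ : ∀ x y → ψ (x + y) ≡ ψ x ⊕ ψ y
  ψ-+ x y = φ-injective (trans≈ (φ-ψ (x + y))
    (trans≈ (+-cong (sym≈ (φ-ψ x)) (sym≈ (φ-ψ y))) (sym≈ (φ-⊕ (ψ x) (ψ y)))))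

  linearCharacter : ∀ u → u ≢ 𝟎 → Character L
  linearCharacter u u≢𝟎 with sgn-nontrivial u u≢𝟎
  ... | v , sgn≡-1 = record
    { χ         = sgn u ∘ ψ
    ; χ-cong    = cong (sgn u) ∘ ψ-cong
    ; χ-isSign  = sgn-isSign u ∘ ψ
    ; χ-+       = λ x y → trans (cong (sgn u) (ψ-+ x y)) (sgn-⊕ u (ψ x) (ψ y))
    ; element₋₁ = φ v
    ; χ-₋₁      = trans (cong (sgn u) (ψ-φ v)) sgn≡-1
    }

  index-φ-↭ : map (index ∘ φ) (cube m) ↭ allFin (2 ^ m)
  index-φ-↭ = map-bijection-↭ (φ-injective ∘ index-injective)
    (λ i → ψ (element i) , trans (index-cong (φ-ψ (element i))) (index-element i))
    (cube-unique m) ∈-cube (Unique.allFin⁺ (2 ^ m)) ∈-allFin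

  map-elements-↭ : {A : Set a} {g : Carrier → A} → (∀ {x y} → x ≈ y → g x ≡ g y) →
    map g elements ↭ map (g ∘ φ) (cube m)
  map-elements-↭ {g = g} g-resp = ↭-trans
    (↭-reflexive (trans (map-tabulate element g) (sym (map-tabulate (λ i → i) (g ∘ element)))))
    (↭-trans (Perm.map⁺ (g ∘ element) (↭-sym index-φ-↭))
      (↭-reflexive (trans (sym (map-∘ (cube m))) (map-cong (λ v → g-resp (element-index (φ v))) (cube m)))))

module Preimages (n m : ℕ) (K : FiniteField c₁ ℓ₁ (2 ^ n)) (L : FiniteField c₂ ℓ₂ (2 ^ m))
         (F : Func (FiniteField.≈-setoid K) (FiniteField.≈-setoid L)) where
  private
    module K where
      open FiniteField K public
      open FieldSum K public
    module L where
      open FiniteField L public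
      open FieldSum L public
  open Func F using (to)
  open Coordinates m L

  fibreSize : L.Carrier → ℕ
  fibreSize β = K.card (λ x → to x L.≟ β)

  fibreSize-cong : ∀ {x y} → x L.≈ y → fibreSize x ≡ fibreSize y
  fibreSize-cong {β} {β′} e = ℤ.+-injective (begin
    + fibreSize β                    ≡⟨ K.card≡∑ (λ x → to x L.≟ β) ⟩
    K.∑ (λ x → ⟦ to x L.≟ β ⟧)       ≡⟨ K.∑-cong (λ x → ⟦⟧-cong (to x L.≟ β) (to x L.≟ β′) (λ p → L.trans p e) (λ p → L.trans p (L.sym e))) ⟩
    K.∑ (λ x → ⟦ to x L.≟ β′ ⟧)      ≡⟨ K.card≡∑ (λ x → to x L.≟ β′) ⟨
    + fibreSize β′                   ∎)
    where open ≡-Reasoning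

  preimageDistribution-↭ : preimageDistribution {n = n} {m = m} K L F ↭ map (fibreSize ∘ φ) (cube m)
  preimageDistribution-↭ = map-elements-↭ fibreSize-cong

  W : Vec Bool m → ℤ
  W u = K.∑ (λ x → sgn u (ψ (to x)))

  W-𝟎 : W 𝟎 ≡ + (2 ^ n)
  W-𝟎 = trans (K.∑-cong (λ x → sgn-𝟎ˡ (ψ (to x)))) (sum-one (2 ^ n))

  hat-W : ∀ v → hat W v ≡ + (2 ^ m) ℤ.* + fibreSize (φ v)
  hat-W v = begin
    hat W v                                             ≡⟨ hat-sum (λ i u → sgn u (ψ (to (K.element i)))) v ⟩
    K.∑ (λ x → hat (λ u → sgn u (ψ (to x))) v)          ≡⟨ K.∑-cong orthogonality ⟩
    K.∑ (λ x → + (2 ^ m) ℤ.* ⟦ to x L.≟ φ v ⟧)          ≡⟨ *-distribˡ-sum {2 ^ n} (+ (2 ^ m)) (λ i → ⟦ to (K.element i) L.≟ φ v ⟧) ⟨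
    + (2 ^ m) ℤ.* K.∑ (λ x → ⟦ to x L.≟ φ v ⟧)          ≡⟨ cong (+ (2 ^ m) ℤ.*_) (K.card≡∑ (λ x → to x L.≟ φ v)) ⟨
    + (2 ^ m) ℤ.* + fibreSize (φ v)                     ∎
    where
    open ≡-Reasoning
    orthogonality : ∀ x → hat (λ u → sgn u (ψ (to x))) v ≡ + (2 ^ m) ℤ.* ⟦ to x L.≟ φ v ⟧
    orthogonality x with Vec.≡-dec Bool._≟_ (ψ (to x)) v
    ... | yes refl = trans (hat-sgn-≡ v) (sym (trans
      (cong (+ (2 ^ m) ℤ.*_) (⟦⟧-yes (to x L.≟ φ v) (L.sym (φ-ψ (to x))))) (ℤ.*-identityʳ _)))
    ... | no ψ≢v   = trans (hat-sgn-≢ v (ψ (to x)) ψ≢v) (sym (trans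
      (cong (+ (2 ^ m) ℤ.*_) (⟦⟧-no (to x L.≟ φ v) (λ e → ψ≢v (trans (ψ-cong e) (ψ-φ v))))) (ℤ.*-zeroʳ (+ (2 ^ m)))))

  module _ (bent : Bent {n = n} {m = m} K L F) where

    W-square : ∀ u → u ≢ 𝟎 → W u ℤ.* W u ≡ + (2 ^ n)
    W-square u u≢𝟎 = walsh-square K L F
      -- Both counts equal the same rational number `2^(n-m)`; injectivity of `fromℤ` turns this
      -- into an equality of natural numbers.
      (λ a a≉0 b b′ → ℤ.+-injective (fromℤ-injective (trans (bent a a≉0 b) (sym (bent a a≉0 b′)))))
      (linearCharacter u u≢𝟎)

    n-even : ∀ u → u ≢ 𝟎 → ∃ λ h → n ≡ h ℕ.* 2
    n-even u u≢𝟎 = square⇒even (W u) (W-square u u≢𝟎)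

    module _ (h : ℕ) (n≡2h : n ≡ h ℕ.* 2) where

      _≟𝟎 : (u : Vec Bool m) → Dec (u ≡ 𝟎)
      u ≟𝟎 = Vec.≡-dec Bool._≟_ u 𝟎

      -- The sign is packed with both conditional properties, and the decision is an argument, so
      -- that the properties of `ε` are projections and need no further case analysis on `u`.
      ε-spec : ∀ u → Dec (u ≡ 𝟎) → ∃ λ s → IsSign s × (u ≡ 𝟎 → s ≡ 1ℤ) × (u ≢ 𝟎 → W u ≡ + (2 ^ h) ℤ.* s)
      ε-spec u (yes u≡𝟎) = 1ℤ , inj₁ refl , (λ _ → refl) , (λ u≢𝟎 → contradiction u≡𝟎 u≢𝟎)
      ε-spec u (no u≢𝟎)  = proj₁ root , proj₁ (proj₂ root) , (λ u≡𝟎 → contradiction u≡𝟎 u≢𝟎) , (λ _ → proj₂ (proj₂ root))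
        where root = square-root h (W u) n≡2h (W-square u u≢𝟎)

      ε : Vec Bool m → ℤ
      ε u = proj₁ (ε-spec u (u ≟𝟎))

      ε-isSign : ∀ u → IsSign (ε u)
      ε-isSign u = proj₁ (proj₂ (ε-spec u (u ≟𝟎)))

      ε-𝟎 : ε 𝟎 ≡ 1ℤ
      ε-𝟎 = proj₁ (proj₂ (proj₂ (ε-spec 𝟎 (𝟎 ≟𝟎)))) refl

      fibreSize-ε : ∀ v → + (2 ^ m) ℤ.* + fibreSize (φ v) ≡ + (2 ^ n) ℤ.+ + (2 ^ h) ℤ.* (hat ε v ℤ.- 1ℤ)
      fibreSize-ε v = begin
        + (2 ^ m) ℤ.* + fibreSize (φ v)
          ≡⟨ hat-W v ⟨
        hat W v
          -- `W` and `2ʰ ε` differ only at `𝟎`, where they are `2ⁿ` and `2ʰ`. The resulting constant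
          -- `2ⁿ - 2ʰ` is the source of the `- 1ℤ` next to `hat ε v`.
          ≡⟨ hat-except-𝟎 W (λ u → + (2 ^ h) ℤ.* ε u) (λ u → proj₂ (proj₂ (proj₂ (ε-spec u (u ≟𝟎))))) v ⟩
        hat (λ u → + (2 ^ h) ℤ.* ε u) v ℤ.+ (W 𝟎 ℤ.- + (2 ^ h) ℤ.* ε 𝟎)
          ≡⟨ cong₂ ℤ._+_ (hat-* (+ (2 ^ h)) ε v) (cong₂ (λ x y → x ℤ.- + (2 ^ h) ℤ.* y) W-𝟎 ε-𝟎) ⟩
        + (2 ^ h) ℤ.* hat ε v ℤ.+ (+ (2 ^ n) ℤ.- + (2 ^ h) ℤ.* 1ℤ)
          ≡⟨ lemma (+ (2 ^ h)) (hat ε v) (+ (2 ^ n)) ⟩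
        + (2 ^ n) ℤ.+ + (2 ^ h) ℤ.* (hat ε v ℤ.- 1ℤ) ∎
        where
        open ≡-Reasoning
        lemma : ∀ x y z → x ℤ.* y ℤ.+ (z ℤ.- x ℤ.* 1ℤ) ≡ z ℤ.+ x ℤ.* (y ℤ.- 1ℤ)
        lemma = solve-∀

-- Everything about F that its preimage distribution depends on.
record SignedSpectrum (n m : ℕ) (sizes : List ℕ) : Set where
  field
    h        : ℕ
    n≡2h     : n ≡ h ℕ.* 2
    ε        : Vec Bool m → ℤ
    ε-isSign : ∀ u → IsSign (ε u)
    ε-𝟎      : ε 𝟎 ≡ 1ℤ
    size     : Vec Bool m → ℕ
    sizes-↭  : sizes ↭ map size (cube m)
    size-ε   : ∀ v → + (2 ^ m) ℤ.* + size v ≡ + (2 ^ n) ℤ.+ + (2 ^ h) ℤ.* (hat ε v ℤ.- 1ℤ)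

bent⇒signedSpectrum : ∀ n m (K : FiniteField c₁ ℓ₁ (2 ^ n)) (L : FiniteField c₂ ℓ₂ (2 ^ suc m))
  (F : Func (FiniteField.≈-setoid K) (FiniteField.≈-setoid L)) → Bent {n = n} {m = suc m} K L F →
  SignedSpectrum n (suc m) (preimageDistribution {n = n} {m = suc m} K L F)
bent⇒signedSpectrum n m K L F bent = record
  { h        = proj₁ even
  ; n≡2h     = proj₂ even
  ; ε        = ε bent (proj₁ even) (proj₂ even)
  ; ε-isSign = ε-isSign bent (proj₁ even) (proj₂ even)
  ; ε-𝟎      = ε-𝟎 bent (proj₁ even) (proj₂ even)
  ; size     = fibreSize ∘ φ
  ; sizes-↭  = preimageDistribution-↭
  ; size-ε   = fibreSize-ε bent (proj₁ even) (proj₂ even)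
  }
  where
  open Coordinates (suc m) L
  open Preimages n (suc m) K L F
  -- Evenness of `n` needs some nonzero `u`, which exists because the codomain has positive
  -- dimension `suc m`.
  even = n-even bent (true ∷ 𝟎) (λ ())

spectrum⇒sizes-↭ : ∀ {sizes} {size : Vec Bool k → ℕ} {ε : Vec Bool k → ℤ} {T} →
  (∀ v → fromℤ (+ size v) ≡ sizeFromSpectrum n (hat ε v)) →
  sizes ↭ map size (cube k) → spectrum ε ↭ doubled T →
  map (λ X → fromℤ (+ X)) sizes ↭ map (preimageSize n) T
spectrum⇒sizes-↭ {k = k} {n = n} {sizes} {size} {ε} {T} size≡ sizes-↭ spectrum-↭ = begin
  map (fromℤ ∘ +_) sizes                        ↭⟨ Perm.map⁺ (fromℤ ∘ +_) sizes-↭ ⟩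
  map (fromℤ ∘ +_) (map size (cube k))          ≡⟨ map-∘ (cube k) ⟨
  map (fromℤ ∘ +_ ∘ size) (cube k)              ≡⟨ map-cong size≡ (cube k) ⟩
  map (sizeFromSpectrum n ∘ hat ε) (cube k)     ≡⟨ map-∘ (cube k) ⟩
  map (sizeFromSpectrum n) (spectrum ε)         ↭⟨ Perm.map⁺ (sizeFromSpectrum n) spectrum-↭ ⟩
  map (sizeFromSpectrum n) (doubled T)          ≡⟨ map-∘ T ⟨
  map (preimageSize n) T                        ∎
  where open PermutationReasoning

classification₄ : ∀ {sizes} → SignedSpectrum n 4 sizes →
  2 ∣ n × ∃ λ T → T ∈ solutions × map (λ X → fromℤ (+ X)) sizes ↭ map (preimageSize n) T
classification₄ {n = n} {sizes} S =
  let T , T∈ , spectrum-↭ = spectrum₄ ε ε-isSign ε-𝟎 in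
  divides h n≡2h , T , T∈ ,
  spectrum⇒sizes-↭ {n = n} {sizes = sizes} {size} {ε} {T}
    (λ v → sizeFromSpectrum-unique h (hat ε v) (size v) n≡2h (size-ε v)) sizes-↭ spectrum-↭
  where open SignedSpectrum S

theorem5p7 : ∀ {c₁ ℓ₁ c₂ ℓ₂ : Level} (n : ℕ)
    (K : FiniteField c₁ ℓ₁ (2 ^ n)) (L : FiniteField c₂ ℓ₂ (2 ^ 4))
    (F : Func (FiniteField.≈-setoid K) (FiniteField.≈-setoid L)) →
    Bent {n = n} {m = 4} K L F →
    2 ∣ n × ∃ λ T → T ∈ solutions ×
    map (λ X → fromℤ (+ X)) (preimageDistribution {n = n} {m = 4} K L F) ↭ map (preimageSize n) T
theorem5p7 n K L F bent = classification₄ (bent⇒signedSpectrum n 3 K L F bent)
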